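{- Let $n\in\mathbb{N}$. If a finite set $X\subseteq\mathbb{N}$ is $\omega^{36n}$-large and exp-sparse, then it is $\mathrm{EM}$-$\omega^n$-large: for every colouring $P:[X]^2\to2$ there exists an $\omega^n$-large $Y\subseteq X$ such that $P$ is transitive on $[Y]^2$.
   Context: Ordinals below $\omega^\omega$ are in Cantor normal form; $\omega^j\cdot m$ = sum of $m$ copies of $\omega^j$. For $m\in\mathbb{N}$: $0[m]=0$, $(\beta+1)[m]=\beta$, $(\beta+\omega^{n})[m]=\beta+\omega^{n-1}\cdot m$ for $n\ge1$. A finite $X=\{x_0<\dots<x_{\ell-1}\}\subseteq\mathbb{N}$ is $\alpha$-large if $\alpha[x_0]\cdots[x_{\ell-1}]=0$. A set $X$ with $\min X\ge3$ is exp-sparse if $x<y$ in $X$ implies $4^x<y$. Pairs in $[Y]^2$ are ordered pairs $(x,y)$ with $x<y$; $P$ is transitive on $[Y]^2$ if both $\{(x,y):P(x,y)=0\}$ and $\{(x,y):P(x,y)=1\}$ restricted to $Y$ are transitive relations, i.e. for $x<y<z$ in $Y$, $P(x,y)=P(y,z)$ implies $P(x,z)=P(x,y)$. -}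

module Defs where

open import Data.Fin.Base using (Fin)
open import Data.List.Base using (List; []; _∷_; _++_; foldl; replicate)
open import Data.List.Membership.Propositional using (_∈_)
open import Data.List.Relation.Binary.Subset.Propositional using () renaming (_⊆_ to _⊆ₗ_)
import Data.List.Relation.Unary.All as All
import Data.List.Relation.Unary.All.Properties as All
open import Data.List.Relation.Unary.AllPairs using (AllPairs; []; _∷_)
import Data.List.Relation.Unary.AllPairs.Properties as AllPairs
open import Data.Nat.Base using (ℕ; zero; suc; _^_; _≤_; _<_)
open import Data.Nat.Properties using (≤-refl; ≤-trans; n≤1+n; <-trans)
open import Data.Product.Base using (_×_; Σ-syntax)
open import Relation.Binary.PropositionalEquality using (_≡_)

-- The Cantor normal form ω^e₁ + ⋯ + ω^eₖ with e₁ ≥ ⋯ ≥ eₖ is stored as the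
-- list eₖ ∷ ⋯ ∷ e₁ ∷ [], so that the head is the exponent of the last summand.
record Ordinal : Set where
  constructor cnf
  field
    exponents : List ℕ
    .normal   : AllPairs _≤_ exponents

open Ordinal public

𝟎 : Ordinal
𝟎 = cnf [] []

ω^_ : ℕ → Ordinal
ω^ j = cnf (j ∷ []) (All.[] ∷ [])

-- (β + 1)[ m ] = β  and  (β + ω^(n+1))[ m ] = β + ω^n · m;  the latter sum is
-- a concatenation because every exponent of β is at least n + 1.
fundamental : List ℕ → ℕ → List ℕ
fundamental []          m = []
fundamental (zero ∷ β)  m = β
fundamental (suc n ∷ β) m = replicate m n ++ β

replicate-normal : ∀ m n → AllPairs _≤_ (replicate m n)
replicate-normal zero    n = []
replicate-normal (suc m) n = All.replicate⁺ m ≤-refl ∷ replicate-normal m n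

fundamental-normal : ∀ α m → AllPairs _≤_ α → AllPairs _≤_ (fundamental α m)
fundamental-normal []          m []      = []
fundamental-normal (zero ∷ β)  m (_ ∷ p) = p
fundamental-normal (suc n ∷ β) m (q ∷ p) =
  AllPairs.++⁺ (replicate-normal m n) p
    (All.replicate⁺ m (All.map (≤-trans (n≤1+n n)) q))

infixl 8 _[_]

_[_] : Ordinal → ℕ → Ordinal
cnf α p [ m ] = cnf (fundamental α m) (fundamental-normal α m p)

record FinSet : Set where
  constructor finSet
  field
    elements    : List ℕ
    .increasing : AllPairs _<_ elements

open FinSet public

infix 4 _∈ₛ_ _⊆_

_∈ₛ_ : ℕ → FinSet → Set
x ∈ₛ X = x ∈ elements X

_⊆_ : FinSet → FinSet → Set
Y ⊆ X = elements Y ⊆ₗ elements X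

_-Large_ : Ordinal → FinSet → Set
α -Large X = foldl _[_] α (elements X) ≡ 𝟎

ExpSparse : FinSet → Set
ExpSparse X =
  (∀ {x} → x ∈ₛ X → 3 ≤ x) ×
  (∀ {x y} → x ∈ₛ X → y ∈ₛ X → x < y → 4 ^ x < y)

record [_]² (X : FinSet) : Set where
  constructor pair
  field
    x y  : ℕ
    .x∈X : x ∈ₛ X
    .y∈X : y ∈ₛ X
    .x<y : x < y

Colouring : FinSet → Set
Colouring X = [ X ]² → Fin 2

restrict : ∀ {X Y} → Y ⊆ X → Colouring X → Colouring Y
restrict Y⊆X P (pair x y x∈Y y∈Y x<y) = P (pair x y (Y⊆X x∈Y) (Y⊆X y∈Y) x<y)

-- For each colour c, the relation { (x , y) ∣ P (x , y) ≡ c } is transitive.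
Transitive : ∀ {Y} → Colouring Y → Set
Transitive {Y} P =
  ∀ (c : Fin 2) {x y z} (x∈ : x ∈ₛ Y) (y∈ : y ∈ₛ Y) (z∈ : z ∈ₛ Y)
    (x<y : x < y) (y<z : y < z) →
  P (pair x y x∈ y∈ x<y) ≡ c →
  P (pair y z y∈ z∈ y<z) ≡ c →
  P (pair x z x∈ z∈ (<-trans x<y y<z)) ≡ c

EM_-Large_ : Ordinal → FinSet → Set
EM α -Large X =
  (P : Colouring X) →
  Σ[ Y ∈ FinSet ] Σ[ Y⊆X ∈ Y ⊆ X ] (α -Large Y × Transitive (restrict {X} {Y} Y⊆X P))

{-# OPTIONS --safe #-}
module Submission where

-- Already ω^(4n)-largeness suffices, by induction on n.  Let x₀ be the least
-- element of an ω^(4n+4)-large X and y the least element of its first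
-- ω^(4n+3)-large piece; after y come y consecutive ω^(4n+2)-large blocks, and
-- y > 2^(x₀+1).  By the pigeonhole principle for large sets (an ω^(N+1)-large
-- sparse set coloured with fewer colours than its minimum has an ω^N-large
-- colour class), each block can be thinned so that every earlier element sees
-- it in a single colour: as elements grow exponentially, there are few possible
-- patterns of colours from below.  A second thinning makes all elements of a
-- block see the later blocks alike.  Repeatedly passing to the majority colour
-- leaves x₀ followed by x₀ blocks, each seeing everything after it in one
-- colour.  Shrinking every block to an ω^n-large transitive set by the
-- induction hypothesis gives an ω^(n+1)-large set, which is transitive because
-- P(x , z) depends only on the block of x whenever x and z lie in different
-- blocks.
--
-- For the pigeonhole principle, run the descent from ω^N separately in each
-- colour class and let c_j be the total coefficient of ω^j over all classes.
-- As long as no class reaches 0, an ω^g-large piece lowers (c_j)_{j ≥ g}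
-- lexicographically: its first element x exceeds c_{g-1}, while the x pieces
-- after x, if nothing changed at levels ≥ g, would lower c_{g-1} x times.

open import Defs
import Algebra.Properties.CommutativeMonoid.Sum
open import Data.Bool.Base using (true; false; if_then_else_)
open import Data.Fin.Base using (Fin; zero; suc; toℕ; fromℕ<; punchIn; finToFun; funToFin)
open import Data.Fin.Properties using (any?; punchInᵢ≢i; finToFun-funToFin; toℕ-fromℕ<) renaming (_≟_ to _≟ᶠ_)
open import Data.Nat.Properties
open import Data.List.Base using (List; []; _∷_; _++_; foldl; replicate; filter; length; concat; lookup)
open import Data.List.Properties
  using (++-assoc; foldl-++; length-++; length-filter; length-replicate; ≡-dec;
         filter-++; filter-none; filter-accept; filter-reject)
open import Data.List.Membership.Propositional using (_∈_)
open import Data.List.Membership.Propositional.Properties using (∈-++⁻; ∈-concat⁻′)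
open import Data.List.Membership.DecPropositional _≟_ using (_∈?_)
open import Data.List.Relation.Binary.Sublist.Propositional
  using ([]; _∷_; _∷ʳ_; minimum; ⊆-refl; ⊆-trans; ⊆-reflexive)
  renaming (_⊆_ to _⊑_; lookup to ⊑-lookup)
open import Data.List.Relation.Binary.Sublist.Propositional.Properties
  using (All-resp-⊆; length-mono-≤; filter-⊆; ++⁺; ++⁺ˡ; ++⁺ʳ)
open import Data.List.Relation.Unary.Any using (here; there; index)
open import Data.List.Relation.Unary.Any.Properties using (lookup-index)
open import Data.List.Relation.Unary.All as All using (All; []; _∷_)
import Data.List.Relation.Unary.All.Properties as All
open import Data.List.Relation.Unary.AllPairs as AllPairs using (AllPairs; []; _∷_; allPairs?)
open import Data.Nat.Base using (ℕ; zero; suc; _+_; _*_; _^_; _≤_; _<_; z≤n; s≤s)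
open import Data.Product.Base using (_×_; _,_; proj₁; ∃; ∃₂)
open import Data.Sum.Base using (_⊎_; inj₁; inj₂)
open import Function.Base using (_∘_)
open import Relation.Binary.Definitions using (tri<; tri≈; tri>)
open import Relation.Binary.PropositionalEquality using (_≡_; _≢_; refl; sym; trans; cong; subst; module ≡-Reasoning)
open import Relation.Nullary.Decidable using (does; yes; no; recompute; dec-true; dec-false)
open import Relation.Nullary.Negation using (contradiction)

open Algebra.Properties.CommutativeMonoid.Sum +-0-commutativeMonoid using (sum; sum-remove; sum-cong-≗)

-- Descent from `ω^n` and the matching decomposition of a set.

-- Exact n X: X is ω^n-large and no proper initial segment of X is;
-- Exacts n m X: the same for ω^n · m.
data Exact  : ℕ → List ℕ → Set
data Exacts : ℕ → ℕ → List ℕ → Set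

data Exact where
  single : ∀ {x} → Exact zero (x ∷ [])
  root   : ∀ {n x X} → Exacts n x X → Exact (suc n) (x ∷ X)

data Exacts where
  none : ∀ {n} → Exacts n zero []
  _◂_  : ∀ {n m A B} → Exact n A → Exacts n m B → Exacts n (suc m) (A ++ B)

exact⇒foldl  : ∀ {n A} → Exact n A → ∀ β → foldl fundamental (n ∷ β) A ≡ β
exacts⇒foldl : ∀ {n m A} → Exacts n m A → ∀ β → foldl fundamental (replicate m n ++ β) A ≡ β

exact⇒foldl single   β = refl
exact⇒foldl (root C) β = exacts⇒foldl C β

exacts⇒foldl none β = refl
exacts⇒foldl {n} {suc m} (_◂_ {A = A} {B} a C) β = begin
  foldl fundamental (n ∷ replicate m n ++ β) (A ++ B)
    ≡⟨ foldl-++ fundamental _ A B ⟩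
  foldl fundamental (foldl fundamental (n ∷ replicate m n ++ β) A) B
    ≡⟨ cong (λ α → foldl fundamental α B) (exact⇒foldl a _) ⟩
  foldl fundamental (replicate m n ++ β) B
    ≡⟨ exacts⇒foldl C β ⟩
  β ∎
  where open ≡-Reasoning

-- The last summand is worked off completely before `β` is touched, so the descent first consumes an
-- exact initial segment.
foldl⇒exact : ∀ n β X → foldl fundamental (n ∷ β) X ≡ [] →
  ∃₂ λ A R → Exact n A × X ≡ A ++ R × foldl fundamental β R ≡ []
foldl⇒exacts : ∀ n m β X → foldl fundamental (replicate m n ++ β) X ≡ [] →
  ∃₂ λ A R → Exacts n m A × X ≡ A ++ R × foldl fundamental β R ≡ []

foldl⇒exact zero    β (x ∷ X) eq = x ∷ [] , X , single , refl , eq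
foldl⇒exact (suc n) β (x ∷ X) eq with foldl⇒exacts n x β X eq
... | A , R , C , refl , eq′ = x ∷ A , R , root C , refl , eq′

foldl⇒exacts n zero    β X eq = [] , X , none , refl , eq
foldl⇒exacts n (suc m) β X eq with foldl⇒exact n (replicate m n ++ β) X eq
... | A , R , a , refl , eq₁ with foldl⇒exacts n m β R eq₁
... | B , S , C , refl , eq₂ = A ++ B , S , a ◂ C , sym (++-assoc A B S) , eq₂

-- Coefficients of Cantor normal forms.

count : ℕ → List ℕ → ℕ
count j L = length (filter (j ≟_) L)

count-++ : ∀ j L M → count j (L ++ M) ≡ count j L + count j M
count-++ j L M = trans (cong length (filter-++ (j ≟_) L M)) (length-++ (filter (j ≟_) L))

count-replicate-≢ : ∀ {j n} m → j ≢ n → count j (replicate m n) ≡ 0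
count-replicate-≢ m j≢n = cong length (filter-none (_ ≟_) (All.replicate⁺ m j≢n))

count-replicate-≤ : ∀ j m n → count j (replicate m n) ≤ m
count-replicate-≤ j m n = ≤-trans (length-filter (j ≟_) (replicate m n)) (≤-reflexive (length-replicate m))

count-∷-≤ : ∀ j e L → count j L ≤ count j (e ∷ L)
count-∷-≤ j e L with does (j ≟ e)
... | true  = n≤1+n _
... | false = ≤-refl

count-fundamental-≥ : ∀ {j e} α x → e ≤ j → count j (fundamental (e ∷ α) x) ≡ count j α
count-fundamental-≥ {e = zero}      α x e≤j = refl
count-fundamental-≥ {j} {suc n} α x n<j =
  trans (count-++ j (replicate x n) α)
        (cong (_+ count j α) (count-replicate-≢ x (>⇒≢ n<j)))

count-fundamental-≤ : ∀ j α x → count j (fundamental α x) ≤ count j α + x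
count-fundamental-≤ j []          x = z≤n
count-fundamental-≤ j (zero ∷ α)  x = ≤-trans (count-∷-≤ j zero α) (m≤m+n _ x)
count-fundamental-≤ j (suc n ∷ α) x = begin
  count j (replicate x n ++ α)          ≡⟨ count-++ j (replicate x n) α ⟩
  count j (replicate x n) + count j α   ≤⟨ +-mono-≤ (count-replicate-≤ j x n) (count-∷-≤ j (suc n) α) ⟩
  x + count j (suc n ∷ α)               ≡⟨ +-comm x _ ⟩
  count j (suc n ∷ α) + x               ∎
  where open ≤-Reasoning

-- Lexicographic descent of coefficient sequences.

SameAbove : ℕ → (c c′ : ℕ → ℕ) → Set
SameAbove g c c′ = ∀ j → g < j → c′ j ≡ c j

LexDrop : ℕ → (c c′ : ℕ → ℕ) → Set
LexDrop g c c′ = ∃ λ ℓ → g ≤ ℓ × SameAbove ℓ c c′ × c′ ℓ < c ℓ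

-- The effect of `m` successive drops at levels at least `g`. A drop above `g` leaves no control
-- over level `g`; without one, the `m` decrements at `g` add up.
Drops : ℕ → ℕ → (c c′ : ℕ → ℕ) → Set
Drops g m c c′ = LexDrop (suc g) c c′ ⊎ (SameAbove g c c′ × c′ g + m ≤ c g)

sameAbove-trans : ∀ {g c c′ c″} → SameAbove g c c′ → SameAbove g c′ c″ → SameAbove g c c″
sameAbove-trans p q j g<j = trans (q j g<j) (p j g<j)

sameAbove-weaken : ∀ {g h c c′} → g ≤ h → SameAbove g c c′ → SameAbove h c c′
sameAbove-weaken g≤h p j h<j = p j (≤-<-trans g≤h h<j)

sameAbove-lexDrop : ∀ {g c c′ c″} → SameAbove g c c′ → LexDrop (suc g) c′ c″ → LexDrop (suc g) c c″
sameAbove-lexDrop p (ℓ , g<ℓ , q , d) =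
  ℓ , g<ℓ , sameAbove-trans (sameAbove-weaken (<⇒≤ g<ℓ) p) q , subst (_ <_) (p ℓ g<ℓ) d

lexDrop-sameAbove : ∀ {g c c′ c″} → LexDrop (suc g) c c′ → SameAbove g c′ c″ → LexDrop (suc g) c c″
lexDrop-sameAbove (ℓ , g<ℓ , q , d) p =
  ℓ , g<ℓ , sameAbove-trans q (sameAbove-weaken (<⇒≤ g<ℓ) p) , subst (_< _) (sym (p ℓ g<ℓ)) d

lexDrop-trans : ∀ {g c c′ c″} → LexDrop g c c′ → LexDrop g c′ c″ → LexDrop g c c″
lexDrop-trans (ℓ , g≤ℓ , p , d) (m , g≤m , q , e) with <-cmp ℓ m
... | tri< ℓ<m _ _    = m , g≤m , sameAbove-trans (sameAbove-weaken (<⇒≤ ℓ<m) p) q , subst (_ <_) (p m ℓ<m) e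
... | tri≈ _ refl _   = ℓ , g≤ℓ , sameAbove-trans p q , <-trans e d
... | tri> _ _ m<ℓ    = ℓ , g≤ℓ , sameAbove-trans p (sameAbove-weaken (<⇒≤ m<ℓ) q) , subst (_< _) (sym (q ℓ m<ℓ)) d

drops-refl : ∀ {g c} → Drops g 0 c c
drops-refl = inj₂ ((λ _ _ → refl) , ≤-reflexive (+-identityʳ _))

lexDrop⇒drops : ∀ {g c c′} → LexDrop g c c′ → Drops g 1 c c′
lexDrop⇒drops {g} {c′ = c′} (ℓ , g≤ℓ , p , d) with m≤n⇒m<n∨m≡n g≤ℓ
... | inj₁ g<ℓ  = inj₁ (ℓ , g<ℓ , p , d)
... | inj₂ refl = inj₂ (p , ≤-trans (≤-reflexive (+-comm (c′ g) 1)) d)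

drops-trans : ∀ {g a b c c′ c″} → Drops g a c c′ → Drops g b c′ c″ → Drops g (a + b) c c″
drops-trans (inj₁ p) (inj₁ q)       = inj₁ (lexDrop-trans p q)
drops-trans (inj₁ p) (inj₂ (q , _)) = inj₁ (lexDrop-sameAbove p q)
drops-trans (inj₂ (p , _)) (inj₁ q) = inj₁ (sameAbove-lexDrop p q)
drops-trans {g} {a} {b} {c} {c′} {c″} (inj₂ (p , d)) (inj₂ (q , e)) = inj₂ (sameAbove-trans p q , (begin
  c″ g + (a + b) ≡⟨ cong (c″ g +_) (+-comm a b) ⟩
  c″ g + (b + a) ≡⟨ +-assoc (c″ g) b a ⟨
  c″ g + b + a   ≤⟨ +-monoˡ-≤ a e ⟩
  c′ g + a       ≤⟨ d ⟩
  c g            ∎))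
  where open ≤-Reasoning

-- Finite sums and exponential growth.

sum-change : ∀ {k} (f g : Fin k → ℕ) i → (∀ l → l ≢ i → f l ≡ g l) → sum f + g i ≡ sum g + f i
sum-change {suc k} f g i f≡g = begin
  sum f + g i        ≡⟨ cong (_+ g i) (sum-remove f) ⟩
  f i + S f + g i    ≡⟨ cong (λ z → f i + z + g i) (sum-cong-≗ λ l → f≡g _ (punchInᵢ≢i i l)) ⟩
  f i + S g + g i    ≡⟨ +-comm _ (g i) ⟩
  g i + (f i + S g)  ≡⟨ cong (g i +_) (+-comm (f i) (S g)) ⟩
  g i + (S g + f i)  ≡⟨ +-assoc (g i) (S g) (f i) ⟨
  g i + S g + f i    ≡⟨ cong (_+ f i) (sum-remove g) ⟨
  sum g + f i        ∎
  where
  open ≡-Reasoning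
  S : (Fin (suc k) → ℕ) → ℕ
  S h = sum (h ∘ punchIn i)

sum-≤ : ∀ {k} (f : Fin k → ℕ) b → (∀ i → f i ≤ b) → sum f ≤ k * b
sum-≤ {zero}  f b f≤b = z≤n
sum-≤ {suc k} f b f≤b = +-mono-≤ (f≤b zero) (sum-≤ (f ∘ suc) b (f≤b ∘ suc))

infix 4 _≪_

_≪_ : ℕ → ℕ → Set
x ≪ y = 2 ^ suc x < y

n<2^n : ∀ n → n < 2 ^ n
n<2^n zero    = s≤s z≤n
n<2^n (suc n) = begin-strict
  1 + n           <⟨ +-mono-≤-< (m^n>0 2 n) (n<2^n n) ⟩
  2 ^ n + 2 ^ n   ≡⟨ cong (2 ^ n +_) (+-identityʳ (2 ^ n)) ⟨
  2 ^ suc n       ∎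
  where open ≤-Reasoning

≪⇒< : ∀ {x y} → x ≪ y → x < y
≪⇒< {x} x≪y = <-trans (<-trans (n<1+n x) (n<2^n (suc x))) x≪y

≪⇒double< : ∀ {x y} → x ≪ y → x + x < y
≪⇒double< {x} {y} x≪y = begin-strict
  x + x         <⟨ +-mono-< (n<2^n x) (n<2^n x) ⟩
  2 ^ x + 2 ^ x ≡⟨ cong (2 ^ x +_) (+-identityʳ (2 ^ x)) ⟨
  2 ^ suc x     <⟨ x≪y ⟩
  y             ∎
  where open ≤-Reasoning

Sparse : List ℕ → Set
Sparse = AllPairs _≪_

allPairs-++⁻ : ∀ {a r} {A : Set a} {R : A → A → Set r} xs {ys} → AllPairs R (xs ++ ys) →
  AllPairs R xs × AllPairs R ys × All (λ x → All (R x) ys) xs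
allPairs-++⁻ []       ps       = [] , ps , []
allPairs-++⁻ (x ∷ xs) (p ∷ ps) with allPairs-++⁻ xs ps
... | qs , rs , cs = All.++⁻ˡ xs p ∷ qs , rs , All.++⁻ʳ xs p ∷ cs

-- The pigeonhole principle for large sets.

module _ {k} (col : ℕ → Fin k) where

  State : Set
  State = Fin k → List ℕ

  step : State → ℕ → State
  step s x i = if does (col x ≟ᶠ i) then fundamental (s i) x else s i

  step-hit : ∀ s x → step s x (col x) ≡ fundamental (s (col x)) x
  step-hit s x rewrite dec-true (col x ≟ᶠ col x) refl = refl

  step-miss : ∀ s x i → i ≢ col x → step s x i ≡ s i
  step-miss s x i i≢ rewrite dec-false (col x ≟ᶠ i) (i≢ ∘ sym) = refl

  foldl-step : ∀ s X i → foldl step s X i ≡ foldl fundamental (s i) (filter (λ x → col x ≟ᶠ i) X)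
  foldl-step s []      i = refl
  foldl-step s (x ∷ X) i with foldl-step (step s x) X i
  ... | eq with does (col x ≟ᶠ i)
  ... | true  = eq
  ... | false = eq

  foldl-step-[] : ∀ s X i → s i ≡ [] → foldl step s X i ≡ []
  foldl-step-[] s []      i eq = eq
  foldl-step-[] s (x ∷ X) i eq = foldl-step-[] (step s x) X i step≡[]
    where
    step≡[] : step s x i ≡ []
    step≡[] with does (col x ≟ᶠ i)
    ... | true  = cong (λ α → fundamental α x) eq
    ... | false = eq

  -- The coefficient of ω^j in the natural sum of the ordinals of all colours.
  coef : State → ℕ → ℕ
  coef s j = sum λ i → count j (s i)

  -- Only the summand of colour `col x` changes; adding its old and new counts crosswise avoids
  -- truncated subtraction.
  coef-step : ∀ s x j → coef (step s x) j + count j (s (col x)) ≡ coef s j + count j (fundamental (s (col x)) x)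
  coef-step s x j = trans
    (sum-change (count j ∘ step s x) (count j ∘ s) (col x) (λ i i≢ → cong (count j) (step-miss s x i i≢)))
    (cong (λ α → coef s j + count j α) (step-hit s x))

  coef-step-≤ : ∀ s x j → coef (step s x) j ≤ coef s j + x
  coef-step-≤ s x j = +-cancelʳ-≤ (count j α) _ _ (begin
    coef (step s x) j + count j α         ≡⟨ coef-step s x j ⟩
    coef s j + count j (fundamental α x)  ≤⟨ +-monoʳ-≤ (coef s j) (count-fundamental-≤ j α x) ⟩
    coef s j + (count j α + x)            ≡⟨ cong (coef s j +_) (+-comm (count j α) x) ⟩
    coef s j + (x + count j α)            ≡⟨ +-assoc (coef s j) x _ ⟨
    coef s j + x + count j α              ∎)
    where
    open ≤-Reasoning
    α = s (col x)

  coef-step-above : ∀ s x {e α} → s (col x) ≡ e ∷ α → SameAbove e (coef s) (coef (step s x))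
  coef-step-above s x {e} {α} eq j e<j = +-cancelʳ-≡ (count j α) _ _ (begin
    coef (step s x) j + count j α
      ≡⟨ cong (λ L → coef (step s x) j + length L) (filter-reject (j ≟_) (>⇒≢ e<j)) ⟨
    coef (step s x) j + count j (e ∷ α)
      ≡⟨ cong (λ L → coef (step s x) j + count j L) eq ⟨
    coef (step s x) j + count j (s (col x))
      ≡⟨ coef-step s x j ⟩
    coef s j + count j (fundamental (s (col x)) x)
      ≡⟨ cong (λ L → coef s j + count j (fundamental L x)) eq ⟩
    coef s j + count j (fundamental (e ∷ α) x)
      ≡⟨ cong (coef s j +_) (count-fundamental-≥ α x (<⇒≤ e<j)) ⟩
    coef s j + count j α ∎)
    where open ≡-Reasoning

  coef-step-at : ∀ s x {e α} → s (col x) ≡ e ∷ α → suc (coef (step s x) e) ≡ coef s e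
  coef-step-at s x {e} {α} eq = +-cancelʳ-≡ (count e α) _ _ (begin
    suc (coef (step s x) e + count e α)
      ≡⟨ +-suc (coef (step s x) e) _ ⟨
    coef (step s x) e + suc (count e α)
      ≡⟨ cong (λ L → coef (step s x) e + length L) (filter-accept (e ≟_) refl) ⟨
    coef (step s x) e + count e (e ∷ α)
      ≡⟨ cong (λ L → coef (step s x) e + count e L) eq ⟨
    coef (step s x) e + count e (s (col x))
      ≡⟨ coef-step s x e ⟩
    coef s e + count e (fundamental (s (col x)) x)
      ≡⟨ cong (λ L → coef s e + count e (fundamental L x)) eq ⟩
    coef s e + count e (fundamental (e ∷ α) x)
      ≡⟨ cong (coef s e +_) (count-fundamental-≥ α x ≤-refl) ⟩
    coef s e + count e α ∎)
    where open ≡-Reasoning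

  step-drop : ∀ s x → s (col x) ≢ [] →
    ∃ λ e → SameAbove e (coef s) (coef (step s x)) × coef (step s x) e < coef s e
  step-drop s x ≢[] with s (col x) in eq
  ... | []    = contradiction refl ≢[]
  ... | e ∷ α = e , coef-step-above s x eq , ≤-reflexive (coef-step-at s x eq)

  Bounds : State → ℕ → Set
  Bounds s x = ∀ j → coef s j < x

  -- A step at `x` adds at most `x` to coefficients below `x`; the result is under `x + x`, which
  -- sparseness puts below all later elements.
  bounds-foldl : ∀ s A {B} → Sparse (A ++ B) → All (Bounds s) (A ++ B) → All (Bounds (foldl step s A)) B
  bounds-foldl s []      ps       bs       = bs
  bounds-foldl s (x ∷ A) (p ∷ ps) (b ∷ bs) = bounds-foldl (step s x) A ps
    (All.map (λ x≪y j → ≤-<-trans (coef-step-≤ s x j)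
                          (<-trans (+-monoˡ-< x (b j)) (≪⇒double< {x} x≪y))) p)

  -- Asking this only at the end suffices, since a descent that reaches 0 stays there.
  Alive : State → List ℕ → Set
  Alive s X = ∀ i → foldl step s X i ≢ []

  -- For exponent `suc g`, the first element `x` lowers some level `e`. If `e > g`, the `x` pieces
  -- that follow cannot undo this drop; otherwise the levels above `g` are still unchanged and the
  -- pieces themselves must drop there.
  exact-drop : ∀ {g A} s → Exact g A → Sparse A → All (Bounds s) A → Alive s A →
    LexDrop g (coef s) (coef (foldl step s A))
  exacts-drop : ∀ {g m A} s → Exacts g m A → Sparse A → All (Bounds s) A → Alive s A →
    Drops g m (coef s) (coef (foldl step s A))

  exact-drop s (single {x}) _ _ alive with step-drop s x (alive (col x) ∘ foldl-step-[] s (x ∷ []) (col x))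
  ... | e , above , at = e , z≤n , above , at
  exact-drop {suc g} s (root {x = x} {X} C) ps bs alive
    with step-drop s x (alive (col x) ∘ foldl-step-[] s (x ∷ X) (col x))
       | exacts-drop (step s x) C (AllPairs.tail ps) (bounds-foldl s (x ∷ []) ps bs) alive
  ... | e , above , at | d with e ≤? g | d
  ... | no e≰g  | inj₁ d′      = lexDrop-trans (e , ≰⇒> e≰g , above , at) d′
  ... | no e≰g  | inj₂ (q , _) = lexDrop-sameAbove (e , ≰⇒> e≰g , above , at) q
  ... | yes e≤g | inj₁ d′      = sameAbove-lexDrop (sameAbove-weaken e≤g above) d′
  -- Here the pieces would lower level `g` by at least `x`, but its coefficient was below `x` and
  -- the first step did not raise it.
  ... | yes e≤g | inj₂ (_ , q) = contradiction
          (≤-trans (m≤n+m x _) (≤-trans q at-g)) (<⇒≱ (All.head bs g))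
    where
    at-g : coef (step s x) g ≤ coef s g
    at-g with m≤n⇒m<n∨m≡n e≤g
    ... | inj₁ e<g  = ≤-reflexive (above g e<g)
    ... | inj₂ refl = <⇒≤ at

  exacts-drop s none ps bs alive = drops-refl
  exacts-drop s (_◂_ {A = A} {B} a C) ps bs alive
    with allPairs-++⁻ A ps
  ... | psA , psB , _ rewrite foldl-++ step s A B = drops-trans
    (lexDrop⇒drops (exact-drop s a psA (All.++⁻ˡ A bs) λ i eq → alive i (foldl-step-[] _ B i eq)))
    (exacts-drop (foldl step s A) C psB (bounds-foldl s A ps bs) alive)

  initial : ℕ → State
  initial n _ = n ∷ []

  coef-initial-≤ : ∀ n j → coef (initial n) j ≤ k
  coef-initial-≤ n j = begin
    coef (initial n) j ≤⟨ sum-≤ {k} (λ _ → count j (n ∷ [])) 1 (λ _ → length-filter (j ≟_) (n ∷ [])) ⟩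
    k * 1              ≡⟨ *-identityʳ k ⟩
    k                  ∎
    where open ≤-Reasoning

  coef-initial-above : ∀ {n j} → n < j → coef (initial n) j ≤ 0
  coef-initial-above {n} {j} n<j = begin
    coef (initial n) j ≤⟨ sum-≤ {k} (λ _ → count j (n ∷ [])) 0
                            (λ _ → ≤-reflexive (cong length (filter-reject (j ≟_) {xs = []} (>⇒≢ n<j)))) ⟩
    k * 0              ≡⟨ *-zeroʳ k ⟩
    0                  ∎
    where open ≤-Reasoning

  -- The initial ordinals have no coefficient above `n`, so the drop there that `exact-drop` would
  -- force is impossible: some colour reaches 0. Initial coefficients are at most `k`, hence below
  -- every element.
  pigeonhole : ∀ {n X} → Exact (suc n) X → Sparse X → All (k <_) X →
    ∃ λ i → foldl fundamental (n ∷ []) (filter (λ x → col x ≟ᶠ i) X) ≡ []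
  pigeonhole {n} {X} e ps k<X
    with any? (λ i → ≡-dec _≟_ (foldl fundamental (n ∷ []) (filter (λ x → col x ≟ᶠ i) X)) [])
  ... | yes found = found
  ... | no ¬found
    with exact-drop (initial n) e ps
           (All.map (λ k<x j → ≤-<-trans (coef-initial-≤ n j) k<x) k<X)
           (λ i eq → ¬found (i , trans (sym (foldl-step (initial n) X i)) eq))
  ... | ℓ , n<ℓ , _ , d = contradiction (<-≤-trans d (coef-initial-above n<ℓ)) n≮0

-- The `q` colourings are coded as one with `2 ^ q` colours; `pigeonhole` then costs one exponent.
homogeneous : ∀ q (f : Fin q → ℕ → Fin 2) {n B} → Exact (suc n) B → Sparse B → All (2 ^ q <_) B →
  ∃ λ D → Exact n D × D ⊑ B × (∀ i {b b′} → b ∈ D → b′ ∈ D → f i b ≡ f i b′)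
homogeneous q f {n} {B} e ps 2^q<B with pigeonhole col e ps 2^q<B
  where
  col : ℕ → Fin (2 ^ q)
  col b = funToFin λ i → f i b
... | c , eq with foldl⇒exact n [] _ eq
... | D , R , d , split , _ = D , d , D⊑B , λ i b∈ b′∈ → trans (value i b∈) (sym (value i b′∈))
  where
  D⊑F = ⊆-trans (++⁺ʳ R ⊆-refl) (⊆-reflexive (sym split))
  D⊑B = ⊆-trans D⊑F (filter-⊆ _ B)
  value : ∀ i {b} → b ∈ D → f i b ≡ finToFun c i
  value i {b} b∈ = trans (sym (finToFun-funToFin (λ i → f i b) i))
    (cong (λ c → finToFun c i) (All.lookup (All-resp-⊆ D⊑F (All.all-filter _ B)) b∈))

-- Sublists, majority colours and lowering the exponent.

allPairs-resp-⊑ : ∀ {a r} {A : Set a} {R : A → A → Set r} {xs ys} → xs ⊑ ys → AllPairs R ys → AllPairs R xs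
allPairs-resp-⊑ []         []       = []
allPairs-resp-⊑ (_ ∷ʳ τ)   (_ ∷ ps) = allPairs-resp-⊑ τ ps
allPairs-resp-⊑ (refl ∷ τ) (p ∷ ps) = All-resp-⊆ τ p ∷ allPairs-resp-⊑ τ ps

concat-⊑ : ∀ {a} {A : Set a} {xss yss : List (List A)} → xss ⊑ yss → concat xss ⊑ concat yss
concat-⊑ []         = []
concat-⊑ (xs ∷ʳ τ)  = ++⁺ˡ xs (concat-⊑ τ)
concat-⊑ (refl ∷ τ) = ++⁺ ⊆-refl (concat-⊑ τ)

length-filter-2 : ∀ {a} {A : Set a} (c : A → Fin 2) xs →
  length (filter (λ x → c x ≟ᶠ zero) xs) + length (filter (λ x → c x ≟ᶠ suc zero) xs) ≡ length xs
length-filter-2 c []       = refl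
length-filter-2 c (x ∷ xs) with c x
... | zero     = cong suc (length-filter-2 c xs)
... | suc zero = trans (+-suc _ _) (cong suc (length-filter-2 c xs))

-- The `suc` on the length accounts for the block that `select` sets aside: if colour 0 occurs fewer
-- than `2 ^ k` times, colour 1 still occurs at least `2 ^ k` times.
majority : ∀ {a} {A : Set a} (c : A → Fin 2) k xs → 2 ^ suc k ≤ suc (length xs) →
  ∃₂ λ i ys → ys ⊑ xs × 2 ^ k ≤ length ys × All (λ y → c y ≡ i) ys
majority c k xs large with 2 ^ k ≤? length (filter (λ x → c x ≟ᶠ zero) xs)
... | yes p = zero , _ , filter-⊆ _ xs , p , All.all-filter _ xs
... | no ¬p = suc zero , _ , filter-⊆ _ xs , +-cancelˡ-≤ (2 ^ k) _ _ (begin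
  2 ^ k + 2 ^ k         ≡⟨ cong (2 ^ k +_) (+-identityʳ (2 ^ k)) ⟨
  2 ^ suc k             ≤⟨ large ⟩
  suc (length xs)       ≡⟨ cong suc (length-filter-2 c xs) ⟨
  suc (length (filter (λ x → c x ≟ᶠ zero) xs)) + length (filter (λ x → c x ≟ᶠ suc zero) xs)
                        ≤⟨ +-monoˡ-≤ _ (≰⇒> ¬p) ⟩
  2 ^ k + length (filter (λ x → c x ≟ᶠ suc zero) xs) ∎) , All.all-filter _ xs
  where open ≤-Reasoning

-- The value 0 at [] is junk: hd is applied to large sets only.
hd : List ℕ → ℕ
hd []      = 0
hd (x ∷ _) = x

hd-∈ : ∀ {n A} → Exact n A → hd A ∈ A
hd-∈ single   = here refl
hd-∈ (root _) = here refl

-- For nonempty `A`, `q` is the successor of its last element, and sparseness gives `2 ^ q` below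
-- `B`.
advance : ∀ p A {B} → Sparse (A ++ B) → All (2 ^ p <_) (A ++ B) →
  ∃ λ q → p ≤ q × All (_< q) A × All (2 ^ q <_) B
advance p []      ps       bs      = p , ≤-refl , [] , bs
advance p (x ∷ A) (p₁ ∷ ps) (b ∷ bs) with advance (suc x) A ps p₁
... | q , x<q , A<q , q<B = q , <⇒≤ (<-trans (<-trans (n<2^n p) b) x<q) , x<q ∷ A<q , q<B

-- Passing to the first piece lowers the exponent by one; a positive minimum ensures that there is a
-- first piece.
descend : ∀ {m n X} → m ≤ n → Exact n X → All (1 ≤_) X → ∃ λ Z → Exact m Z × Z ⊑ X
descend m≤n e pos with m≤n⇒m<n∨m≡n m≤n
descend m≤n e        pos       | inj₂ refl = _ , e , ⊆-refl
descend m≤n (root {x = suc _} (_◂_ {A = A} {B} a _)) (_ ∷ pos) | inj₁ (s≤s m≤n′)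
  with descend m≤n′ a (All.++⁻ˡ A pos)
... | Z , z , Z⊑A = Z , z , _ ∷ʳ ++⁺ʳ B Z⊑A

-- Construction of a large transitive subset.

module _ (P : ℕ → ℕ → Fin 2) where

  Trans : List ℕ → Set
  Trans Y = ∀ c {x y z} → x ∈ Y → y ∈ Y → z ∈ Y → x < y → y < z → P x y ≡ c → P y z ≡ c → P x z ≡ c

  ConstantOn : List ℕ → ℕ → Set
  ConstantOn B a = ∀ b b′ → b ∈ B → b′ ∈ B → P a b ≡ P a b′

  ConstantAfter : List ℕ → List ℕ → Set
  ConstantAfter A B = All (ConstantOn B) A

  trans-single : ∀ x → Trans (x ∷ [])
  trans-single x c (here refl) (here refl) _ x<x = contradiction x<x (n≮n x)

  -- If `x` is in `D` and `z` in `R`, then `P x z` has the constant colour, and so has `P y z` or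
  -- `P x y`, according to the part containing `y`.
  trans-++ : ∀ {D R} c → AllPairs _<_ (D ++ R) → (∀ {d r} → d ∈ D → r ∈ R → P d r ≡ c) →
    Trans D → Trans R → Trans (D ++ R)
  trans-++ {D} {R} c′ inc const tD tR c x∈ y∈ z∈ x<y y<z xy yz
    with allPairs-++⁻ D inc
  ... | _ , _ , D<R with ∈-++⁻ D x∈ | ∈-++⁻ D y∈ | ∈-++⁻ D z∈
  ... | inj₁ x∈D | inj₁ y∈D | inj₁ z∈D = tD c x∈D y∈D z∈D x<y y<z xy yz
  ... | inj₁ x∈D | inj₁ y∈D | inj₂ z∈R = trans (const x∈D z∈R) (trans (sym (const y∈D z∈R)) yz)
  ... | inj₁ x∈D | inj₂ y∈R | inj₂ z∈R = trans (const x∈D z∈R) (trans (sym (const x∈D y∈R)) xy)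
  ... | inj₂ x∈R | inj₂ y∈R | inj₂ z∈R = tR c x∈R y∈R z∈R x<y y<z xy yz
  ... | inj₂ x∈R | inj₁ y∈D | _        = contradiction x<y (<⇒≯ (All.lookup (All.lookup D<R y∈D) x∈R))
  ... | _        | inj₂ y∈R | inj₁ z∈D = contradiction y<z (<⇒≯ (All.lookup (All.lookup D<R z∈D) y∈R))

  -- Every `a < p` supplies a colouring `P a` to be made constant on the block; `advance` then
  -- raises the bound past that block. The last conclusion serves points that precede all blocks.
  thin : ∀ p {n m X} → Exacts (suc n) m X → Sparse X → All (2 ^ p <_) X →
    ∃ λ Bs → length Bs ≡ m × All (Exact n) Bs × concat Bs ⊑ X × AllPairs ConstantAfter Bs ×
             All (λ B → ∀ a → a < p → ConstantOn B a) Bs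
  thin p none ps bs = [] , refl , [] , [] , [] , []
  thin p (_◂_ {A = A} {B} e C) ps bs
    with allPairs-++⁻ A ps | advance p A ps bs
  ... | psA , psB , _ | q , p≤q , A<q , q<B
    with homogeneous p (λ a b → P (toℕ a) b) e psA (All.++⁻ˡ A bs) | thin q C psB q<B
  ... | D , d , D⊑A , const | Bs , len , exacts , Bs⊑B , after , below =
    D ∷ Bs , cong suc len , d ∷ exacts , ++⁺ D⊑A Bs⊑B ,
    All.map (λ h → All.map (h _) (All-resp-⊆ D⊑A A<q)) below ∷ after ,
    (λ a a<p b b′ b∈ b′∈ → subst (λ a → P a _ ≡ P a _) (toℕ-fromℕ< a<p) (const (fromℕ< a<p) b∈ b′∈)) ∷
    All.map (λ h a a<p → h a (<-≤-trans a<p p≤q)) below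

  Solution : ℕ → List ℕ → Set
  Solution n X = ∃ λ Y → Exact n Y × Y ⊑ X × Trans Y

  module _ {n N} (solve : ∀ {D} → Exact N D → Sparse D → All (1 ≤_) D → Solution n D) where

    -- Each round uses the first block and keeps the later blocks of the majority colour, so `2 ^ k`
    -- blocks allow `k` rounds. The bound `y` limits the number of colourings to be made constant on
    -- a block.
    select : ∀ y k Bs → 2 ^ k ≤ length Bs → length Bs ≤ y → All (Exact (suc N)) Bs →
      AllPairs ConstantAfter Bs → Sparse (concat Bs) → All (2 ^ y <_) (concat Bs) →
      ∃ λ Y → Exacts n k Y × Y ⊑ concat Bs × Trans Y
    select y zero Bs _ _ _ _ _ _ = [] , none , minimum _ , λ _ ()
    select y (suc k) [] large _ _ _ _ _ = contradiction large (<⇒≱ (m^n>0 2 (suc k)))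
    select y (suc k) (B ∷ Cs) large small (e ∷ es) (B-const ∷ const) ps bs
      with allPairs-++⁻ B ps
    ... | psB , psCs , _
      -- By `ConstantAfter`, the head of a later block stands for the whole block.
      with homogeneous (length Cs) (λ i b → P b (hd (lookup Cs i))) e psB
             (All.map (≤-<-trans (^-monoʳ-≤ 2 (≤-trans (n≤1+n _) small))) (All.++⁻ˡ B bs))
    ... | D , d , D⊑B , D-const
      with majority (λ C → P (hd D) (hd C)) k Cs large
    ... | c , Ds , Ds⊑Cs , many , colour
      with solve d (allPairs-resp-⊑ D⊑B psB)
             (All-resp-⊆ D⊑B (All.map (≤-trans (s≤s z≤n)) (All.++⁻ˡ B bs)))
         | select y k Ds many (≤-trans (length-mono-≤ Ds⊑Cs) (≤-trans (n≤1+n _) small))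
             (All-resp-⊆ Ds⊑Cs es) (allPairs-resp-⊑ Ds⊑Cs const)
             (allPairs-resp-⊑ (concat-⊑ Ds⊑Cs) psCs) (All-resp-⊆ (concat-⊑ Ds⊑Cs) (All.++⁻ʳ B bs))
    ... | Y , exact , Y⊑D , tY | Z , exacts , Z⊑Ds , tZ =
      Y ++ Z , exact ◂ exacts , YZ⊑ ,
      trans-++ c (AllPairs.map ≪⇒< (allPairs-resp-⊑ YZ⊑ ps))
        (λ y∈ z∈ → constant (⊑-lookup Y⊑D y∈) (⊑-lookup Z⊑Ds z∈)) tY tZ
      where
      YZ⊑ : Y ++ Z ⊑ B ++ concat Cs
      YZ⊑ = ++⁺ (⊆-trans Y⊑D D⊑B) (⊆-trans Z⊑Ds (concat-⊑ Ds⊑Cs))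
      constant : ∀ {a r} → a ∈ D → r ∈ concat Ds → P a r ≡ c
      constant {a} {r} a∈D r∈ with ∈-concat⁻′ Ds r∈
      ... | C , r∈C , C∈Ds = begin
        P a r            ≡⟨ All.lookup (All.lookup B-const C∈Cs) (⊑-lookup D⊑B a∈D) _ _ r∈C (hd-∈ (All.lookup es C∈Cs)) ⟩
        P a (hd C)       ≡⟨ cong (P a ∘ hd) C≡ ⟩
        P a (hd C′)      ≡⟨ D-const (index C∈Cs) a∈D (hd-∈ d) ⟩
        P (hd D) (hd C′) ≡⟨ cong (P (hd D) ∘ hd) C≡ ⟨
        P (hd D) (hd C)  ≡⟨ All.lookup colour C∈Ds ⟩
        c                ∎
        where
        open ≡-Reasoning
        C∈Cs = ⊑-lookup Ds⊑Cs C∈Ds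
        C′ = lookup Cs (index C∈Cs)
        C≡ : C ≡ C′
        C≡ = lookup-index C∈Cs

  -- The four exponents are spent on the first element, on `y`, in `thin`, and on `homogeneous`
  -- inside `select`.
  transitive-sublist : ∀ n {X} → Exact (n * 4) X → Sparse X → All (1 ≤_) X → Solution n X
  transitive-sublist zero    (single {x}) _ _ = x ∷ [] , single , ⊆-refl , trans-single x
  transitive-sublist (suc n) (root none)  _ (() ∷ _)
  transitive-sublist (suc n) (root {x = suc x} (_◂_ {B = R} (root {x = y} {Ys} C) _)) ps _
    with ps
  ... | p ∷ (q ∷ qs)
    -- As `suc y` exceeds the first element, `below` covers that element; sparseness gives
    -- `2 ^ suc y` below all of `Ys`.
    with thin (suc y) C (proj₁ (allPairs-++⁻ Ys qs)) (All.++⁻ˡ Ys q)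
  ... | Bs , len , exacts , Bs⊑Ys , after , below
    -- There are `y` blocks, and `2 ^ suc (suc x) < y` by sparseness.
    with majority (λ B → P (suc x) (hd B)) (suc x) Bs
           (subst (λ l → _ ≤ suc l) (sym len) (<⇒≤ (<-trans (All.head p) (n<1+n y))))
  ... | c , Ds , Ds⊑Bs , many , colour
    with select (transitive-sublist n) y (suc x) Ds many
           (≤-trans (length-mono-≤ Ds⊑Bs) (≤-reflexive len))
           (All-resp-⊆ Ds⊑Bs exacts) (allPairs-resp-⊑ Ds⊑Bs after)
           (allPairs-resp-⊑ Ds⊑ (proj₁ (allPairs-++⁻ Ys qs)))
           (All.map (≤-<-trans (^-monoʳ-≤ 2 (n≤1+n y))) (All-resp-⊆ Ds⊑ (All.++⁻ˡ Ys q)))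
    where
    Ds⊑ : concat Ds ⊑ Ys
    Ds⊑ = ⊆-trans (concat-⊑ Ds⊑Bs) Bs⊑Ys
  ... | Z , Z-exacts , Z⊑Ds , tZ =
    suc x ∷ Z , root Z-exacts , Z⊑ ,
    trans-++ c (AllPairs.map ≪⇒< (allPairs-resp-⊑ Z⊑ ps))
      (λ { (here refl) z∈ → constant (⊑-lookup Z⊑Ds z∈) }) (trans-single (suc x)) tZ
    where
    Z⊑ : suc x ∷ Z ⊑ suc x ∷ y ∷ Ys ++ R
    Z⊑ = refl ∷ y ∷ʳ ++⁺ʳ R (⊆-trans Z⊑Ds (⊆-trans (concat-⊑ Ds⊑Bs) Bs⊑Ys))
    constant : ∀ {r} → r ∈ concat Ds → P (suc x) r ≡ c
    constant r∈ with ∈-concat⁻′ Ds r∈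
    ... | C , r∈C , C∈Ds = trans
      (All.lookup below C∈Bs _ (<-trans (≪⇒< (All.head p)) (n<1+n y)) _ _ r∈C (hd-∈ (All.lookup exacts C∈Bs)))
      (All.lookup colour C∈Ds)
      where C∈Bs = ⊑-lookup Ds⊑Bs C∈Ds

  large⇒transitive-sublist : ∀ n X → foldl fundamental (36 * n ∷ []) X ≡ [] → Sparse X → All (1 ≤_) X →
    Solution n X
  large⇒transitive-sublist n X large sparse positive with foldl⇒exact (36 * n) [] X large
  ... | A , R , a , refl , _ with descend n*4≤36*n a (All.++⁻ˡ A positive)
    where
    n*4≤36*n : n * 4 ≤ 36 * n
    n*4≤36*n = subst (n * 4 ≤_) (*-comm n 36) (*-monoʳ-≤ n (m≤m+n 4 32))
  ... | Z , z , Z⊑A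
    with transitive-sublist n z (allPairs-resp-⊑ (++⁺ʳ R Z⊑A) sparse) (All-resp-⊆ (++⁺ʳ R Z⊑A) positive)
  ... | Y , y , Y⊑Z , tY = Y , y , ⊆-trans Y⊑Z (++⁺ʳ R Z⊑A) , tY

-- Transfer to finite sets and their colourings.

extend : ∀ {X} → Colouring X → ℕ → ℕ → Fin 2
extend {X} P x y with x ∈? elements X | y ∈? elements X | x <? y
... | yes x∈ | yes y∈ | yes x<y = P (pair x y x∈ y∈ x<y)
... | _      | _      | _       = zero

-- The decided membership and order proofs may differ from the given ones, but `pair` stores them as
-- irrelevant, so `refl` suffices.
extend-≡ : ∀ {X} (P : Colouring X) {x y} (x∈ : x ∈ₛ X) (y∈ : y ∈ₛ X) (x<y : x < y) →
  extend P x y ≡ P (pair x y x∈ y∈ x<y)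
extend-≡ {X} P {x} {y} x∈ y∈ x<y with x ∈? elements X | y ∈? elements X | x <? y
... | yes _  | yes _  | yes _  = refl
... | no x∉  | _      | _      = contradiction x∈ x∉
... | yes _  | no y∉  | _      = contradiction y∈ y∉
... | yes _  | yes _  | no x≮y = contradiction x<y x≮y

exponents-foldl : ∀ α X → exponents (foldl _[_] α X) ≡ foldl fundamental (exponents α) X
exponents-foldl α []      = refl
exponents-foldl α (x ∷ X) = exponents-foldl (α [ x ]) X

exponents≡[]⇒≡𝟎 : ∀ α → exponents α ≡ [] → α ≡ 𝟎
exponents≡[]⇒≡𝟎 (cnf [] _) refl = refl

expSparse⇒sparse : ∀ X → ExpSparse X → Sparse (elements X)
expSparse⇒sparse (finSet X inc) (3≤ , sparse) =
  -- The order proof of a `FinSet` is irrelevant; decidability lets it be recovered.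
  sparse-on X (recompute (allPairs? _<?_ X) inc) (λ x∈ → x∈)
  where
  ≪-intro : ∀ {x y} → 3 ≤ x → 4 ^ x < y → x ≪ y
  ≪-intro {x} 3≤x = ≤-<-trans (begin
    2 ^ suc x    ≤⟨ ^-monoʳ-≤ 2 (+-monoˡ-≤ x (≤-trans (s≤s z≤n) 3≤x)) ⟩
    2 ^ (x + x)  ≡⟨ cong (λ z → 2 ^ (x + z)) (+-identityʳ x) ⟨
    2 ^ (2 * x)  ≡⟨ ^-*-assoc 2 2 x ⟨
    4 ^ x        ∎)
    where open ≤-Reasoning
  sparse-on : ∀ Z → AllPairs _<_ Z → (∀ {x} → x ∈ Z → x ∈ X) → Sparse Z
  sparse-on []      []       Z⊆X = []
  sparse-on (x ∷ Z) (p ∷ ps) Z⊆X =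
    All.tabulate (λ y∈ → ≪-intro (3≤ (Z⊆X (here refl)))
      (sparse (Z⊆X (here refl)) (Z⊆X (there y∈)) (All.lookup p y∈)))
    ∷ sparse-on Z ps (Z⊆X ∘ there)

theorem2p10 : (n : ℕ) (X : FinSet) → (ω^ (36 * n)) -Large X → ExpSparse X → EM (ω^ n) -Large X
theorem2p10 n X large expSparse P
  with large⇒transitive-sublist (extend P) n (elements X)
         (trans (sym (exponents-foldl (ω^ (36 * n)) (elements X))) (cong exponents large))
         (expSparse⇒sparse X expSparse)
         (All.tabulate λ x∈ → ≤-trans (s≤s z≤n) (proj₁ expSparse x∈))
... | Y , y , Y⊑X , tY =
  finSet Y (AllPairs.map ≪⇒< (allPairs-resp-⊑ Y⊑X (expSparse⇒sparse X expSparse))) ,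
  Y⊆X ,
  exponents≡[]⇒≡𝟎 _ (trans (exponents-foldl (ω^ n) Y) (exact⇒foldl y [])) ,
  λ c x∈ y∈ z∈ x<y y<z xy yz →
    trans (sym (extend-≡ P (Y⊆X x∈) (Y⊆X z∈) (<-trans x<y y<z)))
      (tY c x∈ y∈ z∈ x<y y<z (trans (extend-≡ P (Y⊆X x∈) (Y⊆X y∈) x<y) xy)
                             (trans (extend-≡ P (Y⊆X y∈) (Y⊆X z∈) y<z) yz))
  where
  Y⊆X : ∀ {x} → x ∈ Y → x ∈ₛ X
  Y⊆X = ⊑-lookup Y⊑X
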